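{- (Completeness of the delay-free semantics.) For any statement $s$, state $\sigma$, resumption $r:\mathit{res}$ and proof $h:r{\Downarrow}$ of responsiveness of $r$, if $(s,\sigma)\Rightarrow r$, then $(s,\sigma)\Rightarrow_{\mathrm r}\mathit{norm}~r~h$.
   Context: Language. Given sets of variables $x$ and pure expressions $e$; values are integers; states $\sigma$ map variables to integers; $\sigma[x\mapsto v]$ is state update; $\llbracket e\rrbracket\sigma\in\mathbb Z$ is the value of $e$ in $\sigma$; $\sigma\models e$ means $\llbracket e\rrbracket\sigma\neq 0$. Statements: $s::=\mathsf{skip}\mid s_0;s_1\mid x:=e\mid\mathsf{if}~e~\mathsf{then}~s_t~\mathsf{else}~s_f\mid\mathsf{while}~e~\mathsf{do}~s_t\mid\mathsf{input}~x\mid\mathsf{output}~e$. Delayful resumptions $r:\mathit{res}$ are defined coinductively by the constructors $\mathit{ret}~\sigma$, $\mathit{in}~f$ ($f:\mathbb Z\to\mathit{res}$), $\mathit{out}~v~r$ ($v\in\mathbb Z$), $\delta~r$. Strong bisimilarity $\approx$ is defined coinductively: $\mathit{ret}~\sigma\approx\mathit{ret}~\sigma$; $\mathit{in}~f\approx\mathit{in}~f_*$ if $\forall v.\,f\,v\approx f_*\,v$; $\mathit{out}~v~r\approx\mathit{out}~v~r_*$ if $r\approx r_*$; $\delta~r\approx\delta~r_*$ if $r\approx r_*$. Delay-free resumptions $r:\mathit{res}_{\mathrm r}$ are defined coinductively by constructors $\mathit{ret}_{\mathrm r}~\sigma$, $\mathit{in}_{\mathrm r}~f$ ($f:\mathbb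 Z\to\mathit{res}_{\mathrm r}$), $\mathit{out}_{\mathrm r}~v~r$, with strong bisimilarity $\approx$ defined coinductively by the analogous congruence rules. Strongly bisimilar resumptions count as equal (setoids with equality $\approx$), and all relations on resumptions are understood to respect $\approx$. Convergence $r\downarrow r'$ on $\mathit{res}$ is inductive: $\mathit{ret}~\sigma\downarrow\mathit{ret}~\sigma$; $\mathit{in}~f\downarrow\mathit{in}~f_*$ if $\forall v.\,f\,v\approx f_*\,v$; $\mathit{out}~v~r\downarrow\mathit{out}~v~r_*$ if $r\approx r_*$; $\delta~r\downarrow r'$ if $r\downarrow r'$. Responsiveness $r{\Downarrow}$ is a (proof-relevant) coinductive predicate with constructors: $\mathsf{resp\mbox{ - }ret}~\sigma~c$ proving $r{\Downarrow}$ from $c:r\downarrow\mathit{ret}~\sigma$; $\mathsf{resp\mbox{ - }in}~f~c~k$ proving $r{\Downarrow}$ from $c:r\downarrow\mathit{in}~f$ and $k:\forall v.\,(f\,v){\Downarrow}$; $\mathsf{resp\mbox{ - }out}~v~r'~c~h$ proving $r{\Downarrow}$ from $c:r\downarrow\mathit{out}~v~r'$ and $h:r'{\Downarrow}$. Normalization $\mathit{norm}:(r:\mathit{res})\to r{\Downarrow}\to\mathit{res}_{\mathrm r}$ is defined corecursively by inspecting the proof: $\mathit{norm}~r~(\mathsf{resp\mbox{ - }ret}~\sigma~\_)=\mathit{ret}_{\mathrm r}~\sigma$; $\mathit{norm}~r~(\mathsf{resp\mbox{ - }in}~f~\_~k)=\mathit{in}_{\mathrm r}(\lambda v.\,\mathit{norm}~(f\,v)~(k\,v))$;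 $\mathit{norm}~r~(\mathsf{resp\mbox{ - }out}~v~r'~\_~h)=\mathit{out}_{\mathrm r}~v~(\mathit{norm}~r'~h)$. Delayful big-step semantics. Evaluation $(s,\sigma)\Rightarrow r$ and its extended evaluation, written here $(s,r)\Rightarrow^{\mathrm{ext}}r'$ (on $\mathit{res}$), are defined mutually coinductively by: $(x:=e,\sigma)\Rightarrow\delta(\mathit{ret}~\sigma[x\mapsto\llbracket e\rrbracket\sigma])$; $(\mathsf{skip},\sigma)\Rightarrow\mathit{ret}~\sigma$; $(s_0;s_1,\sigma)\Rightarrow r'$ if $(s_0,\sigma)\Rightarrow r$ and $(s_1,r)\Rightarrow^{\mathrm{ext}}r'$; $(\mathsf{if}~e~\mathsf{then}~s_t~\mathsf{else}~s_f,\sigma)\Rightarrow r$ if either $\sigma\models e$ and $(s_t,\delta(\mathit{ret}~\sigma))\Rightarrow^{\mathrm{ext}}r$, or $\sigma\not\models e$ and $(s_f,\delta(\mathit{ret}~\sigma))\Rightarrow^{\mathrm{ext}}r$; $(\mathsf{while}~e~\mathsf{do}~s_t,\sigma)\Rightarrow r'$ if $\sigma\models e$, $(s_t,\delta(\mathit{ret}~\sigma))\Rightarrow^{\mathrm{ext}}r$ and $(\mathsf{while}~e~\mathsf{do}~s_t,r)\Rightarrow^{\mathrm{ext}}r'$; $(\mathsf{while}~e~\mathsf{do}~s_t,\sigma)\Rightarrow\delta(\mathit{ret}~\sigma)$ if $\sigma\not\models e$; $(\mathsf{input}~x,\sigma)\Rightarrow\mathit{in}(\lambda v.\,\mathit{ret}~\sigma[x\mapsto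 v])$; $(\mathsf{output}~e,\sigma)\Rightarrow\mathit{out}~(\llbracket e\rrbracket\sigma)~(\mathit{ret}~\sigma)$; $(s,\mathit{ret}~\sigma)\Rightarrow^{\mathrm{ext}}r$ if $(s,\sigma)\Rightarrow r$; $(s,\mathit{in}~f)\Rightarrow^{\mathrm{ext}}\mathit{in}~f'$ if $\forall v.\,(s,f\,v)\Rightarrow^{\mathrm{ext}}f'\,v$; $(s,\mathit{out}~v~r)\Rightarrow^{\mathrm{ext}}\mathit{out}~v~r'$ if $(s,r)\Rightarrow^{\mathrm{ext}}r'$; $(s,\delta~r)\Rightarrow^{\mathrm{ext}}\delta~r'$ if $(s,r)\Rightarrow^{\mathrm{ext}}r'$. Delay-free big-step semantics. For a relation $X$ between pairs (statement, delay-free resumption) and delay-free resumptions, written $(s,r)\mathbin X r'$, the relation $(s,\sigma)\mathbin{{\Rightarrow}{\downarrow}(X)}r$ ($r:\mathit{res}_{\mathrm r}$) is defined inductively; abbreviate it $(s,\sigma)\Downarrow_X r$: $(x:=e,\sigma)\Downarrow_X\mathit{ret}_{\mathrm r}(\sigma[x\mapsto\llbracket e\rrbracket\sigma])$; $(\mathsf{skip},\sigma)\Downarrow_X\mathit{ret}_{\mathrm r}~\sigma$; $(s_0;s_1,\sigma)\Downarrow_X r$ if $(s_0,\sigma)\Downarrow_X\mathit{ret}_{\mathrm r}~\sigma'$ and $(s_1,\sigma')\Downarrow_X r$; $(s_0;s_1,\sigma)\Downarrow_X\mathit{in}_{\mathrm r}~f'$ if $(s_0,\sigma)\Downarrow_X\mathit{in}_{\mathrm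 r}~f$ and $\forall v.\,(s_1,f\,v)\mathbin X f'\,v$; $(s_0;s_1,\sigma)\Downarrow_X\mathit{out}_{\mathrm r}~v~r'$ if $(s_0,\sigma)\Downarrow_X\mathit{out}_{\mathrm r}~v~r$ and $(s_1,r)\mathbin X r'$; $(\mathsf{if}~e~\mathsf{then}~s_t~\mathsf{else}~s_f,\sigma)\Downarrow_X r$ if $\sigma\models e$ and $(s_t,\sigma)\Downarrow_X r$, or $\sigma\not\models e$ and $(s_f,\sigma)\Downarrow_X r$; with $w=\mathsf{while}~e~\mathsf{do}~s_t$: $(w,\sigma)\Downarrow_X r$ if $\sigma\models e$, $(s_t,\sigma)\Downarrow_X\mathit{ret}_{\mathrm r}~\sigma'$ and $(w,\sigma')\Downarrow_X r$; $(w,\sigma)\Downarrow_X\mathit{in}_{\mathrm r}~f'$ if $\sigma\models e$, $(s_t,\sigma)\Downarrow_X\mathit{in}_{\mathrm r}~f$ and $\forall v.\,(w,f\,v)\mathbin X f'\,v$; $(w,\sigma)\Downarrow_X\mathit{out}_{\mathrm r}~v~r'$ if $\sigma\models e$, $(s_t,\sigma)\Downarrow_X\mathit{out}_{\mathrm r}~v~r$ and $(w,r)\mathbin X r'$; $(w,\sigma)\Downarrow_X\mathit{ret}_{\mathrm r}~\sigma$ if $\sigma\not\models e$; $(\mathsf{input}~x,\sigma)\Downarrow_X\mathit{in}_{\mathrm r}(\lambda v.\,\mathit{ret}_{\mathrm r}~\sigma[x\mapsto v])$; $(\mathsf{output}~e,\sigma)\Downarrow_X\mathit{out}_{\mathrm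 r}~(\llbracket e\rrbracket\sigma)~(\mathit{ret}_{\mathrm r}~\sigma)$. Extended evaluation $(s,r)\stackrel{*}{\Rightarrow}r'$ on $\mathit{res}_{\mathrm r}$ is the coinductively defined (greatest) relation with rules: $(s,\mathit{ret}_{\mathrm r}~\sigma)\stackrel{*}{\Rightarrow}r$ if there is a relation $X\subseteq{\stackrel{*}{\Rightarrow}}$ with $(s,\sigma)\Downarrow_X r$; $(s,\mathit{in}_{\mathrm r}~f)\stackrel{*}{\Rightarrow}\mathit{in}_{\mathrm r}~f'$ if $\forall v.\,(s,f\,v)\stackrel{*}{\Rightarrow}f'\,v$; $(s,\mathit{out}_{\mathrm r}~v~r)\stackrel{*}{\Rightarrow}\mathit{out}_{\mathrm r}~v~r'$ if $(s,r)\stackrel{*}{\Rightarrow}r'$. Finally $(s,\sigma)\Rightarrow_{\mathrm r}r$ iff $(s,\sigma)\mathbin{{\Rightarrow}{\downarrow}({\stackrel{*}{\Rightarrow}})}r$. -}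

module Defs where

open import Data.Integer.Base using (ℤ; 0ℤ)
open import Data.List.Base using (List; []; _∷_)
open import Data.Product.Base using (Σ; Σ-syntax; _×_; _,_)
open import Data.Unit.Base using (⊤; tt)
open import Level using (Level; _⊔_; 0ℓ) renaming (suc to lsuc)
open import Relation.Binary.Core using (Rel)
open import Relation.Binary.Definitions using (DecidableEquality; _Respects₂_)
open import Relation.Binary.PropositionalEquality.Core using (_≢_)
open import Relation.Nullary.Decidable.Core using (yes; no)
open import Relation.Nullary.Negation.Core using (¬_)
open import Relation.Unary using (Pred; _⊆_)

private
  variable
    a i ℓ ℓ′ : Level

1ℓ 2ℓ : Level
1ℓ = lsuc 0ℓ
2ℓ = lsuc 1ℓ

-- A coinductively defined predicate is the greatest fixed point of its (monotone)
-- one-step rule operator F, i.e. the union of the post-fixed points of F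
-- (Knaster–Tarski).  A derivation consists of a predicate P, a map that gives for
-- every proof of P its last rule with premises again in P, and a proof of P; so ν F
-- is also meaningful as a proof-relevant predicate (a coalgebra with a state).
-- The operators below are container-like with small premise sets, so that
-- predicates of one fixed universe level suffice.

ν : {I : Set i} → (Pred I ℓ → Pred I ℓ′) → Pred I (i ⊔ lsuc ℓ ⊔ ℓ′)
ν {i = i} {ℓ = ℓ} {I = I} F x = Σ[ P ∈ Pred I ℓ ] (P ⊆ F P) × P x

record Language : Set₁ where
  field
    Var : Set
    _≟_ : DecidableEquality Var

  State : Set
  State = Var → ℤ

  field
    Exp  : Set
    ⟦_⟧_ : Exp → State → ℤ

module Semantics (L : Language) where
  open Language L public

  infix 9 _[_↦_]
  infix 4 _⊨_

  _[_↦_] : State → Var → ℤ → State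
  (σ [ x ↦ v ]) y with x ≟ y
  ... | yes _ = v
  ... | no  _ = σ y

  _⊨_ : State → Exp → Set
  σ ⊨ e = ⟦ e ⟧ σ ≢ 0ℤ

  infix  20 _≔_
  infixr 10 _⨾_

  data Stmt : Set where
    skip          : Stmt
    _⨾_           : Stmt → Stmt → Stmt
    _≔_           : Var → Exp → Stmt
    if_then_else_ : Exp → Stmt → Stmt → Stmt
    while         : Exp → Stmt → Stmt
    input         : Var → Stmt
    output        : Exp → Stmt

  private
    variable
      x        : Var
      e        : Exp
      s s₀ s₁ sₜ s𝒻 : Stmt
      σ σ′     : State
      v        : ℤ

  data ResF (A : Set a) : Set a where
    retF : State → ResF A
    inF  : (ℤ → A) → ResF A
    outF : ℤ → A → ResF A
    δF   : A → ResF A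

  -- The final coalgebra of ResF, up to _≈_.  As a stream is a function on ℕ, a
  -- (possibly infinite) tree is a function that sends a position to the node there.
  -- A position lists child indices from the root: the children of an in-node are
  -- indexed by ℤ, the only child of an out- or δ-node has index 0.  Values at
  -- positions outside the tree are never observed by view, hence ignored by _≈_.

  Res : Set
  Res = List ℤ → ResF ⊤

  graft : {A : Set a} → ResF ⊤ → (ℤ → A) → ResF A
  graft (retF σ)   _ = retF σ
  graft (inF _)    k = inF k
  graft (outF v _) k = outF v (k 0ℤ)
  graft (δF _)     k = δF (k 0ℤ)

  view : Res → ResF Res
  view r = graft (r []) (λ v p → r (v ∷ p))

  -- The constructors satisfy view (ret σ) = retF σ, view (inp f) = inF f,
  -- view (out v r) = outF v r and view (δ r) = δF r definitionally.

  ret : State → Res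
  ret σ _ = retF σ

  inp : (ℤ → Res) → Res
  inp f []      = inF _
  inp f (v ∷ p) = f v p

  out : ℤ → Res → Res
  out v r []      = outF v tt
  out v r (_ ∷ p) = r p

  δ : Res → Res
  δ r []      = δF tt
  δ r (_ ∷ p) = r p

  data BisimF (R : Rel Res ℓ) : Rel (ResF Res) ℓ where
    ≈ret : BisimF R (retF σ) (retF σ)
    ≈in  : {f f⋆ : ℤ → Res} → (∀ v → R (f v) (f⋆ v)) → BisimF R (inF f) (inF f⋆)
    ≈out : {r r⋆ : Res} → R r r⋆ → BisimF R (outF v r) (outF v r⋆)
    ≈δ   : {r r⋆ : Res} → R r r⋆ → BisimF R (δF r) (δF r⋆)

  infix 4 _≈_ _↓_

  _≈_ : Rel Res 1ℓ
  r ≈ r⋆ = ν (λ R (r , r⋆) → BisimF (λ r r⋆ → R (r , r⋆)) (view r) (view r⋆)) (r , r⋆)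

  data ResFᵣ (A : Set a) : Set a where
    retF : State → ResFᵣ A
    inF  : (ℤ → A) → ResFᵣ A
    outF : ℤ → A → ResFᵣ A

  Resᵣ : Set
  Resᵣ = List ℤ → ResFᵣ ⊤

  graftᵣ : {A : Set a} → ResFᵣ ⊤ → (ℤ → A) → ResFᵣ A
  graftᵣ (retF σ)   _ = retF σ
  graftᵣ (inF _)    k = inF k
  graftᵣ (outF v _) k = outF v (k 0ℤ)

  viewᵣ : Resᵣ → ResFᵣ Resᵣ
  viewᵣ r = graftᵣ (r []) (λ v p → r (v ∷ p))

  retᵣ : State → Resᵣ
  retᵣ σ _ = retF σ

  inᵣ : (ℤ → Resᵣ) → Resᵣ
  inᵣ f []      = inF _
  inᵣ f (v ∷ p) = f v p

  outᵣ : ℤ → Resᵣ → Resᵣ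
  outᵣ v r []      = outF v tt
  outᵣ v r (_ ∷ p) = r p

  -- Corecursion: unfoldᵣ c z is retᵣ σ, inᵣ (λ v → unfoldᵣ c (k v)) or
  -- outᵣ v (unfoldᵣ c z′) when c z is retF σ, inF k or outF v z′.

  unfoldᵣ  : {A : Set a} → (A → ResFᵣ A) → A → Resᵣ
  unfoldᵣ′ : {A : Set a} → (A → ResFᵣ A) → ResFᵣ A → Resᵣ
  unfoldᵣ c z p = unfoldᵣ′ c (c z) p
  unfoldᵣ′ c (retF σ)    _       = retF σ
  unfoldᵣ′ c (inF k)     []      = inF _
  unfoldᵣ′ c (inF k)     (v ∷ p) = unfoldᵣ c (k v) p
  unfoldᵣ′ c (outF v z′) []      = outF v tt
  unfoldᵣ′ c (outF v z′) (_ ∷ p) = unfoldᵣ c z′ p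

  data BisimFᵣ (R : Rel Resᵣ ℓ) : Rel (ResFᵣ Resᵣ) ℓ where
    ≈ᵣret : BisimFᵣ R (retF σ) (retF σ)
    ≈ᵣin  : {f f⋆ : ℤ → Resᵣ} → (∀ v → R (f v) (f⋆ v)) → BisimFᵣ R (inF f) (inF f⋆)
    ≈ᵣout : {r r⋆ : Resᵣ} → R r r⋆ → BisimFᵣ R (outF v r) (outF v r⋆)

  infix 4 _≈ᵣ_

  _≈ᵣ_ : Rel Resᵣ 1ℓ
  r ≈ᵣ r⋆ = ν (λ R (r , r⋆) → BisimFᵣ (λ r r⋆ → R (r , r⋆)) (viewᵣ r) (viewᵣ r⋆)) (r , r⋆)

  -- Relations on resumptions must respect strong bisimilarity.  From here on, where
  -- a rule has a constructor form in its conclusion, the form is therefore required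
  -- up to _≈_ (or _≈ᵣ_) only.

  data _↓_ : Res → Res → Set₁ where
    ↓ret : {r r′ : Res} →
           r ≈ ret σ → r′ ≈ ret σ → r ↓ r′
    ↓in  : {r r′ : Res} {f f⋆ : ℤ → Res} →
           r ≈ inp f → r′ ≈ inp f⋆ → (∀ v → f v ≈ f⋆ v) → r ↓ r′
    ↓out : {r r′ q q⋆ : Res} →
           r ≈ out v q → r′ ≈ out v q⋆ → q ≈ q⋆ → r ↓ r′
    ↓δ   : {r r′ q : Res} →
           r ≈ δ q → q ↓ r′ → r ↓ r′

  data RespF (P : Pred Res 1ℓ) (r : Res) : Set₁ where
    resp-ret : (σ : State) → r ↓ ret σ → RespF P r
    resp-in  : (f : ℤ → Res) → r ↓ inp f → (∀ v → P (f v)) → RespF P r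
    resp-out : (v : ℤ) (r′ : Res) → r ↓ out v r′ → P r′ → RespF P r

  infix 4 _⇓

  _⇓ : Pred Res 2ℓ
  _⇓ = ν RespF

  norm-step : {P : Pred Res 1ℓ} → P ⊆ RespF P → Σ Res P → ResFᵣ (Σ Res P)
  norm-step α (r , h) with α h
  ... | resp-ret σ _       = retF σ
  ... | resp-in f _ k      = inF (λ v → f v , k v)
  ... | resp-out v r′ _ h′ = outF v (r′ , h′)

  norm : (r : Res) → r ⇓ → Resᵣ
  norm r (P , α , h) = unfoldᵣ (norm-step α) (r , h)

  -- The conclusions of the two mutually defined relations, so that both are obtained
  -- as one greatest fixed point.
  data Judgement : Set where
    eval : Stmt → State → Res → Judgement
    ext  : Stmt → Res → Res → Judgement

  data EvalF (H : Pred Judgement 1ℓ) : Pred Judgement 1ℓ where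
    assign   : {r : Res} → r ≈ δ (ret (σ [ x ↦ ⟦ e ⟧ σ ])) →
               EvalF H (eval (x ≔ e) σ r)
    skip     : {r : Res} → r ≈ ret σ →
               EvalF H (eval skip σ r)
    seq      : {r r′ : Res} → H (eval s₀ σ r) → H (ext s₁ r r′) →
               EvalF H (eval (s₀ ⨾ s₁) σ r′)
    if-true  : {r : Res} → σ ⊨ e → H (ext sₜ (δ (ret σ)) r) →
               EvalF H (eval (if e then sₜ else s𝒻) σ r)
    if-false : {r : Res} → ¬ σ ⊨ e → H (ext s𝒻 (δ (ret σ)) r) →
               EvalF H (eval (if e then sₜ else s𝒻) σ r)
    while-true  : {r r′ : Res} → σ ⊨ e →
                  H (ext sₜ (δ (ret σ)) r) → H (ext (while e sₜ) r r′) →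
                  EvalF H (eval (while e sₜ) σ r′)
    while-false : {r : Res} → ¬ σ ⊨ e → r ≈ δ (ret σ) →
                  EvalF H (eval (while e sₜ) σ r)
    input    : {r : Res} → r ≈ inp (λ v → ret (σ [ x ↦ v ])) →
               EvalF H (eval (input x) σ r)
    output   : {r : Res} → r ≈ out (⟦ e ⟧ σ) (ret σ) →
               EvalF H (eval (output e) σ r)
    ext-ret  : {r r′ : Res} → r ≈ ret σ → H (eval s σ r′) →
               EvalF H (ext s r r′)
    ext-in   : {r r′ : Res} {f f′ : ℤ → Res} → r ≈ inp f → r′ ≈ inp f′ →
               (∀ v → H (ext s (f v) (f′ v))) → EvalF H (ext s r r′)
    ext-out  : {r r′ q q′ : Res} → r ≈ out v q → r′ ≈ out v q′ →
               H (ext s q q′) → EvalF H (ext s r r′)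
    ext-δ    : {r r′ q q′ : Res} → r ≈ δ q → r′ ≈ δ q′ →
               H (ext s q q′) → EvalF H (ext s r r′)

  infix 4 ⟨_,_⟩⇒_ ⟨_,_⟩⇒ᵉˣᵗ_

  ⟨_,_⟩⇒_ : Stmt → State → Res → Set₂
  ⟨ s , σ ⟩⇒ r = ν EvalF (eval s σ r)

  ⟨_,_⟩⇒ᵉˣᵗ_ : Stmt → Res → Res → Set₂
  ⟨ s , r ⟩⇒ᵉˣᵗ r′ = ν EvalF (ext s r r′)

  infix 4 _⊢⟨_,_⟩⇓_ ⟨_,_⟩⇒*_ ⟨_,_⟩⇒ᵣ_

  data _⊢⟨_,_⟩⇓_ (X : Pred (Stmt × Resᵣ × Resᵣ) ℓ) :
                 Stmt → State → Resᵣ → Set (1ℓ ⊔ ℓ) where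
    assign   : {r : Resᵣ} → r ≈ᵣ retᵣ (σ [ x ↦ ⟦ e ⟧ σ ]) →
               X ⊢⟨ x ≔ e , σ ⟩⇓ r
    skip     : {r : Resᵣ} → r ≈ᵣ retᵣ σ →
               X ⊢⟨ skip , σ ⟩⇓ r
    seq-ret  : {r : Resᵣ} →
               X ⊢⟨ s₀ , σ ⟩⇓ retᵣ σ′ → X ⊢⟨ s₁ , σ′ ⟩⇓ r →
               X ⊢⟨ s₀ ⨾ s₁ , σ ⟩⇓ r
    seq-in   : {r : Resᵣ} {f f′ : ℤ → Resᵣ} → r ≈ᵣ inᵣ f′ →
               X ⊢⟨ s₀ , σ ⟩⇓ inᵣ f → (∀ v → X (s₁ , f v , f′ v)) →
               X ⊢⟨ s₀ ⨾ s₁ , σ ⟩⇓ r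
    seq-out  : {r q q′ : Resᵣ} → r ≈ᵣ outᵣ v q′ →
               X ⊢⟨ s₀ , σ ⟩⇓ outᵣ v q → X (s₁ , q , q′) →
               X ⊢⟨ s₀ ⨾ s₁ , σ ⟩⇓ r
    if-true  : {r : Resᵣ} → σ ⊨ e → X ⊢⟨ sₜ , σ ⟩⇓ r →
               X ⊢⟨ if e then sₜ else s𝒻 , σ ⟩⇓ r
    if-false : {r : Resᵣ} → ¬ σ ⊨ e → X ⊢⟨ s𝒻 , σ ⟩⇓ r →
               X ⊢⟨ if e then sₜ else s𝒻 , σ ⟩⇓ r
    while-ret   : {r : Resᵣ} → σ ⊨ e →
                  X ⊢⟨ sₜ , σ ⟩⇓ retᵣ σ′ → X ⊢⟨ while e sₜ , σ′ ⟩⇓ r →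
                  X ⊢⟨ while e sₜ , σ ⟩⇓ r
    while-in    : {r : Resᵣ} {f f′ : ℤ → Resᵣ} → r ≈ᵣ inᵣ f′ → σ ⊨ e →
                  X ⊢⟨ sₜ , σ ⟩⇓ inᵣ f → (∀ v → X (while e sₜ , f v , f′ v)) →
                  X ⊢⟨ while e sₜ , σ ⟩⇓ r
    while-out   : {r q q′ : Resᵣ} → r ≈ᵣ outᵣ v q′ → σ ⊨ e →
                  X ⊢⟨ sₜ , σ ⟩⇓ outᵣ v q → X (while e sₜ , q , q′) →
                  X ⊢⟨ while e sₜ , σ ⟩⇓ r
    while-false : {r : Resᵣ} → r ≈ᵣ retᵣ σ → ¬ σ ⊨ e →
                  X ⊢⟨ while e sₜ , σ ⟩⇓ r
    input    : {r : Resᵣ} → r ≈ᵣ inᵣ (λ v → retᵣ (σ [ x ↦ v ])) →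
               X ⊢⟨ input x , σ ⟩⇓ r
    output   : {r : Resᵣ} → r ≈ᵣ outᵣ (⟦ e ⟧ σ) (retᵣ σ) →
               X ⊢⟨ output e , σ ⟩⇓ r

  data ExtF (R : Pred (Stmt × Resᵣ × Resᵣ) 1ℓ) : Pred (Stmt × Resᵣ × Resᵣ) 2ℓ where
    *ret : {r r′ : Resᵣ} → r ≈ᵣ retᵣ σ →
          (X : Pred (Stmt × Resᵣ × Resᵣ) 1ℓ) →
          (∀ t → (λ q q′ → X (t , q , q′)) Respects₂ _≈ᵣ_) →
          X ⊆ R → X ⊢⟨ s , σ ⟩⇓ r′ →
          ExtF R (s , r , r′)
    *in : {r r′ : Resᵣ} {f f′ : ℤ → Resᵣ} → r ≈ᵣ inᵣ f → r′ ≈ᵣ inᵣ f′ →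
          (∀ v → R (s , f v , f′ v)) → ExtF R (s , r , r′)
    *out : {r r′ q q′ : Resᵣ} → r ≈ᵣ outᵣ v q → r′ ≈ᵣ outᵣ v q′ →
          R (s , q , q′) → ExtF R (s , r , r′)

  ⇒* : Pred (Stmt × Resᵣ × Resᵣ) 2ℓ
  ⇒* = ν ExtF

  ⟨_,_⟩⇒*_ : Stmt → Resᵣ → Resᵣ → Set₂
  ⟨ s , r ⟩⇒* r′ = ⇒* (s , r , r′)

  ⟨_,_⟩⇒ᵣ_ : Stmt → State → Resᵣ → Set₂
  ⟨ s , σ ⟩⇒ᵣ r = ⇒* ⊢⟨ s , σ ⟩⇓ r

{-# OPTIONS --safe #-}

-- A resumption r and a delay-free resumption q are related by _⇝_ when q is the
-- normal form of r.  The normal forms of an intermediate resumption r, where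
-- (s , r) ⇒ᵉˣᵗ r′ and r′ is responsive, exist because extended evaluation passes
-- every delay of r on to r′: r cannot delay longer than r′ does.  For the same
-- reason evaluation can be followed by lexicographic induction on the number of
-- delays before the first observable action and on the statement, as each turn of a
-- loop consumes a delay.  The pairs of normal forms of r and r′ with
-- (s , r) ⇒ᵉˣᵗ r′ then form a post-fixed point of the rules for _⇒*_.

module Submission where

open import Data.Integer.Base using (ℤ)
open import Data.Nat.Base using (ℕ; zero; suc)
open import Data.Product.Base using (Σ-syntax; ∃-syntax; _×_; _,_; proj₁; proj₂)
open import Data.Unit.Base using (⊤; tt)
open import Function.Base using (id; _∘_)
open import Level using (Level; _⊔_)
open import Relation.Binary.Definitions using (_Respects₂_)
open import Relation.Binary.PropositionalEquality using (_≡_; refl; subst)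
open import Relation.Unary using (Pred; _⊆_)

open import Defs

private
  variable
    a b ℓ ℓ′ : Level

module NormalForms (L : Language) where
  open Semantics L

  private
    variable
      A B     : Set a
      m n     : ℕ
      s       : Stmt
      σ       : State
      v w     : ℤ
      r r′ r″ : Res
      q q′    : Resᵣ
      x x′ x″ : ResF Res

  -- Strong bisimilarity on both kinds of resumptions.

  BisimF-map : {R : Res → Res → Set ℓ} {S : Res → Res → Set ℓ′} →
               (∀ {r r′} → R r r′ → S r r′) → BisimF R x x′ → BisimF S x x′
  BisimF-map φ ≈ret     = ≈ret
  BisimF-map φ (≈in k)  = ≈in (λ v → φ (k v))
  BisimF-map φ (≈out e) = ≈out (φ e)
  BisimF-map φ (≈δ e)   = ≈δ (φ e)

  BisimF-sym : {R : Res → Res → Set ℓ} {S : Res → Res → Set ℓ′} →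
               (∀ {r r′} → R r r′ → S r′ r) → BisimF R x x′ → BisimF S x′ x
  BisimF-sym φ ≈ret     = ≈ret
  BisimF-sym φ (≈in k)  = ≈in (λ v → φ (k v))
  BisimF-sym φ (≈out e) = ≈out (φ e)
  BisimF-sym φ (≈δ e)   = ≈δ (φ e)

  BisimF-trans : {R : Res → Res → Set a} {S : Res → Res → Set b} {T : Res → Res → Set ℓ} →
                 (∀ {r r′ r″} → R r r′ → S r′ r″ → T r r″) →
                 BisimF R x x′ → BisimF S x′ x″ → BisimF T x x″
  BisimF-trans φ ≈ret     ≈ret      = ≈ret
  BisimF-trans φ (≈in k)  (≈in k′)  = ≈in (λ v → φ (k v) (k′ v))
  BisimF-trans φ (≈out e) (≈out e′) = ≈out (φ e e′)
  BisimF-trans φ (≈δ e)   (≈δ e′)   = ≈δ (φ e e′)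

  ≈-unfold : r ≈ r′ → BisimF _≈_ (view r) (view r′)
  ≈-unfold (R , β , e) = BisimF-map (λ e′ → R , β , e′) (β e)

  ≈-refl : r ≈ r
  ≈-refl = (λ (r , r′) → r ≡ r′) , (λ { {r , _} refl → refl-step (view r) }) , refl
    where
    refl-step : ∀ x → BisimF _≡_ x x
    refl-step (retF σ)   = ≈ret
    refl-step (inF f)    = ≈in (λ _ → refl)
    refl-step (outF v r) = ≈out refl
    refl-step (δF r)     = ≈δ refl

  ≈-sym : r ≈ r′ → r′ ≈ r
  ≈-sym (R , β , e) = (λ (r , r′) → R (r′ , r)) , (λ e′ → BisimF-sym id (β e′)) , e

  ≈-trans : r ≈ r′ → r′ ≈ r″ → r ≈ r″
  ≈-trans (R , β , e) (S , γ , e′) =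
    (λ (r , r″) → Σ[ r′ ∈ Res ] R (r , r′) × S (r′ , r″)) ,
    (λ (_ , e₁ , e₂) → BisimF-trans (λ e₃ e₄ → _ , e₃ , e₄) (β e₁) (γ e₂)) ,
    (_ , e , e′)

  BisimFᵣ-map : {R : Resᵣ → Resᵣ → Set ℓ} {S : Resᵣ → Resᵣ → Set ℓ′} {y y′ : ResFᵣ Resᵣ} →
                (∀ {q q′} → R q q′ → S q q′) → BisimFᵣ R y y′ → BisimFᵣ S y y′
  BisimFᵣ-map φ ≈ᵣret     = ≈ᵣret
  BisimFᵣ-map φ (≈ᵣin k)  = ≈ᵣin (λ v → φ (k v))
  BisimFᵣ-map φ (≈ᵣout e) = ≈ᵣout (φ e)

  ≈ᵣ-unfold : q ≈ᵣ q′ → BisimFᵣ _≈ᵣ_ (viewᵣ q) (viewᵣ q′)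
  ≈ᵣ-unfold (R , β , e) = BisimFᵣ-map (λ e′ → R , β , e′) (β e)

  -- Normal forms of delayful resumptions.

  mapᵣ : (A → B) → ResFᵣ A → ResFᵣ B
  mapᵣ f (retF σ)   = retF σ
  mapᵣ f (inF k)    = inF (λ v → f (k v))
  mapᵣ f (outF v z) = outF v (f z)

  viewᵣ-unfoldᵣ : (c : A → ResFᵣ A) (z : A) →
                  viewᵣ (unfoldᵣ c z) ≡ mapᵣ (unfoldᵣ c) (c z)
  viewᵣ-unfoldᵣ c z = go (c z)
    where
    go : ∀ y → viewᵣ (unfoldᵣ′ c y) ≡ mapᵣ (unfoldᵣ c) y
    go (retF σ)   = refl
    go (inF k)    = refl
    go (outF v z) = refl

  -- The index n bounds the number of leading delays.
  data NormF {B : Set b} (N : Res → B → Set ℓ) : ℕ → ResF Res → ResFᵣ B → Set (b ⊔ ℓ) where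
    ⇝ret : NormF N n (retF σ) (retF σ)
    ⇝in  : {f : ℤ → Res} {g : ℤ → B} →
           (∀ v → N (f v) (g v)) → NormF N n (inF f) (inF g)
    ⇝out : {r : Res} {z : B} → N r z → NormF N n (outF v r) (outF v z)
    ⇝δ   : {r : Res} {y : ResFᵣ B} → NormF N n (view r) y → NormF N (suc n) (δF r) y

  module _ {B : Set b} {N : Res → B → Set ℓ} where

    NormF-weaken : {y : ResFᵣ B} → NormF N n x y → NormF N (suc n) x y
    NormF-weaken ⇝ret     = ⇝ret
    NormF-weaken (⇝in k)  = ⇝in k
    NormF-weaken (⇝out k) = ⇝out k
    NormF-weaken (⇝δ d)   = ⇝δ (NormF-weaken d)

    NormF-map : {N′ : Res → B → Set ℓ′} {y : ResFᵣ B} →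
                (∀ {r z} → N r z → N′ r z) → NormF N n x y → NormF N′ n x y
    NormF-map φ ⇝ret     = ⇝ret
    NormF-map φ (⇝in k)  = ⇝in (λ v → φ (k v))
    NormF-map φ (⇝out k) = ⇝out (φ k)
    NormF-map φ (⇝δ d)   = ⇝δ (NormF-map φ d)

    NormF-mapᵣ : {N′ : Res → A → Set ℓ′} {y : ResFᵣ B} (f : B → A) →
                 (∀ {r z} → N r z → N′ r (f z)) → NormF N n x y → NormF N′ n x (mapᵣ f y)
    NormF-mapᵣ f φ ⇝ret     = ⇝ret
    NormF-mapᵣ f φ (⇝in k)  = ⇝in (λ v → φ (k v))
    NormF-mapᵣ f φ (⇝out k) = ⇝out (φ k)
    NormF-mapᵣ f φ (⇝δ d)   = ⇝δ (NormF-mapᵣ f φ d)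

    -- Bisimilar resumptions have the same leading delays, so the bound `n` is kept; the recursions
    -- on `n` below rely on this.
    NormF-respˡ : {y : ResFᵣ B} → (∀ {r r′ z} → r ≈ r′ → N r′ z → N r z) →
                  BisimF _≈_ x x′ → NormF N n x′ y → NormF N n x y
    NormF-respˡ φ ≈ret     ⇝ret     = ⇝ret
    NormF-respˡ φ (≈in e)  (⇝in k)  = ⇝in (λ v → φ (e v) (k v))
    NormF-respˡ φ (≈out e) (⇝out k) = ⇝out (φ e k)
    NormF-respˡ φ (≈δ e)   (⇝δ d)   = ⇝δ (NormF-respˡ φ (≈-unfold e) d)

    -- The bound grows by one for each delay that the convergence derivation strips.
    ↓-NormF : {y : ResFᵣ B} → (∀ {r r′ z} → r ≈ r′ → N r′ z → N r z) →
              r ↓ r′ → NormF N n (view r′) y → ∃[ m ] NormF N m (view r) y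
    ↓-NormF φ (↓ret e e′)   d =
      _ , NormF-respˡ φ (≈-unfold (≈-trans e (≈-sym e′))) d
    ↓-NormF φ (↓in e e′ k)  d =
      _ , NormF-respˡ φ (≈-unfold e)
            (NormF-respˡ φ (≈in k) (NormF-respˡ φ (≈-unfold (≈-sym e′)) d))
    ↓-NormF φ (↓out e e′ k) d =
      _ , NormF-respˡ φ (≈-unfold e)
            (NormF-respˡ φ (≈out k) (NormF-respˡ φ (≈-unfold (≈-sym e′)) d))
    ↓-NormF φ (↓δ e c)      d with ↓-NormF φ c d
    ... | _ , d′ = _ , NormF-respˡ φ (≈-unfold e) (⇝δ d′)

  NormF-respʳ : {N N′ : Res → Resᵣ → Set ℓ} {y y′ : ResFᵣ Resᵣ} →
                (∀ {r q q′} → q ≈ᵣ q′ → N r q → N′ r q′) →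
                BisimFᵣ _≈ᵣ_ y y′ → NormF N n x y → NormF N′ n x y′
  NormF-respʳ φ ≈ᵣret     ⇝ret     = ⇝ret
  NormF-respʳ φ (≈ᵣin e)  (⇝in k)  = ⇝in (λ v → φ (e v) (k v))
  NormF-respʳ φ (≈ᵣout e) (⇝out k) = ⇝out (φ e k)
  NormF-respʳ φ e         (⇝δ d)   = ⇝δ (NormF-respʳ φ e d)

  -- Both derivations follow the delays of `x`, so they reach the same observable node even if their
  -- bounds differ.
  NormF-unique : {N : Res → Resᵣ → Set ℓ} {y y′ : ResFᵣ Resᵣ} →
                 NormF N m x y → NormF N n x y′ →
                 BisimFᵣ (λ q q′ → Σ[ r ∈ Res ] N r q × N r q′) y y′
  NormF-unique ⇝ret     ⇝ret      = ≈ᵣret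
  NormF-unique (⇝in k)  (⇝in k′)  = ≈ᵣin (λ v → _ , k v , k′ v)
  NormF-unique (⇝out k) (⇝out k′) = ≈ᵣout (_ , k , k′)
  NormF-unique (⇝δ d)   (⇝δ d′)   = NormF-unique d d′

  -- The greatest fixed point of NormF is taken as the limit of its finite
  -- approximants: unlike ν, this relation is in the lowest universe and nevertheless
  -- contains the post-fixed points of every universe level.
  infix 4 _⇝[_]_ _⇝_

  _⇝[_]_ : Res → ℕ → Resᵣ → Set
  r ⇝[ zero ]  q = ⊤
  r ⇝[ suc k ] q = ∃[ n ] NormF (λ r q → r ⇝[ k ] q) n (view r) (viewᵣ q)

  _⇝_ : Res → Resᵣ → Set
  r ⇝ q = ∀ k → r ⇝[ k ] q

  ⇝-fold : NormF _⇝_ n (view r) (viewᵣ q) → r ⇝ q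
  ⇝-fold d zero    = tt
  ⇝-fold d (suc k) = _ , NormF-map (λ N → N k) d

  -- The approximant at level 1 already fixes the delays and the first observable node. All other
  -- approximants share this shape, so inverting them level by level gives the limit at each child.
  ⇝-unfold : r ⇝ q → ∃[ n ] NormF _⇝_ n (view r) (viewᵣ q)
  ⇝-unfold N = _ , limit (proj₂ (N 1)) (λ k → N (suc k))
    where
    out-inv : {N : Res → Resᵣ → Set} → NormF N n (outF v r) (outF w q) → N r q
    out-inv (⇝out N) = N

    limit : ∀ {N x y} → NormF N n x y →
            (∀ k → ∃[ m ] NormF (λ r q → r ⇝[ k ] q) m x y) → NormF _⇝_ n x y
    limit ⇝ret     h = ⇝ret
    limit (⇝in _)  h = ⇝in (λ v k → in-inv (proj₂ (h k)) v)
      where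
      in-inv : ∀ {N f g} → NormF N n (inF f) (inF g) → ∀ v → N (f v) (g v)
      in-inv (⇝in k) = k
    limit (⇝out _) h = ⇝out (λ k → out-inv (proj₂ (h k)))
    limit (⇝δ d)   h = ⇝δ (limit d (λ k → δ-inv (proj₂ (h k))))
      where
      δ-inv : ∀ {N y} → NormF N n (δF r) y → ∃[ m ] NormF N m (view r) y
      δ-inv (⇝δ d) = _ , d

  ⇝-respˡ : r ≈ r′ → r′ ⇝ q → r ⇝ q
  ⇝-respˡ e N k = go k e (N k)
    where
    go : ∀ k {r r′ q} → r ≈ r′ → r′ ⇝[ k ] q → r ⇝[ k ] q
    go zero    e _       = tt
    go (suc k) e (_ , d) = _ , NormF-respˡ (go k) (≈-unfold e) d

  ⇝-respʳ : q ≈ᵣ q′ → r ⇝ q → r ⇝ q′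
  ⇝-respʳ e N k = go k e (N k)
    where
    go : ∀ k {r q q′} → q ≈ᵣ q′ → r ⇝[ k ] q → r ⇝[ k ] q′
    go zero    e _       = tt
    go (suc k) e (_ , d) = _ , NormF-respʳ (go k) (≈ᵣ-unfold e) d

  ⇝-unique : r ⇝ q → r ⇝ q′ → q ≈ᵣ q′
  ⇝-unique N N′ =
    (λ (q , q′) → Σ[ r ∈ Res ] r ⇝ q × r ⇝ q′) ,
    (λ (_ , M , M′) → NormF-unique (proj₂ (⇝-unfold M)) (proj₂ (⇝-unfold M′))) ,
    (_ , N , N′)

  -- Equal first nodes need not come from equal functions on positions; uniqueness of the normal
  -- form of `r` yields bisimilarity instead.
  NormF-≈ᵣ : {r : Res} → NormF _⇝_ n (view r) (viewᵣ q) → viewᵣ q ≡ viewᵣ q′ → q ≈ᵣ q′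
  NormF-≈ᵣ {r = r} d e = ⇝-unique {r = r} (⇝-fold d) (⇝-fold (subst (NormF _⇝_ _ _) e d))

  -- A coinduction principle: each seed `z` stands for the resumption `π z` that it normalizes. The
  -- proof is by induction on the level of the approximant.
  unfoldᵣ-⇝ : (c : A → ResFᵣ A) (π : A → Res) →
              (∀ z → ∃[ n ] NormF (λ r z → r ≈ π z) n (view (π z)) (c z)) →
              ∀ {r} z → r ≈ π z → r ⇝ unfoldᵣ c z
  unfoldᵣ-⇝ c π h z e zero = tt
  unfoldᵣ-⇝ c π h z e (suc k) rewrite viewᵣ-unfoldᵣ c z =
    _ , NormF-mapᵣ (unfoldᵣ c) (λ {_} {z′} e′ → unfoldᵣ-⇝ c π h z′ e′ k)
          (NormF-respˡ ≈-trans (≈-unfold e) (proj₂ (h z)))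

  norm-⇝ : (h : r ⇓) → r ⇝ norm r h
  norm-⇝ (P , α , h) = unfoldᵣ-⇝ (norm-step α) proj₁ step (_ , h) ≈-refl
    where
    step : ∀ z → ∃[ n ] NormF (λ r z → r ≈ proj₁ z) n (view (proj₁ z)) (norm-step α z)
    step (r , h) with α h
    -- The target of the convergence shows its node at once, hence the initial bound 0.
    ... | resp-ret σ c      = ↓-NormF {n = 0} ≈-trans c ⇝ret
    ... | resp-in f c k     = ↓-NormF {n = 0} ≈-trans c (⇝in (λ v → ≈-refl))
    ... | resp-out v r′ c k = ↓-NormF {n = 0} ≈-trans c (⇝out ≈-refl)

  -- Normal forms along an evaluation.

  module Evaluation (H : Pred Judgement 1ℓ) (γ : H ⊆ EvalF H) where

    -- Using the fixed coalgebra `H` rather than `⟨_,_⟩⇒ᵉˣᵗ_` keeps this relation at level `1ℓ`, as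
    -- `ExtF` requires of its post-fixed points.
    NormalExt : Pred (Stmt × Resᵣ × Resᵣ) 1ℓ
    NormalExt (s , q , q′) =
      Σ[ r ∈ Res ] Σ[ r′ ∈ Res ] H (ext s r r′) × r ⇝ q × r′ ⇝ q′

    -- The seeds for computing the normal form of the first component; the normal form of the second
    -- bounds the search.
    Pending : Stmt → Set₁
    Pending s = Σ[ r ∈ Res ] Σ[ r′ ∈ Res ] Σ[ q′ ∈ Resᵣ ] H (ext s r r′) × r′ ⇝ q′

    source : Pending s → Res
    source = proj₁

    result : Pending s → Resᵣ
    result (_ , _ , q′ , _) = q′

    -- When (s , r) ⇒ᵉˣᵗ r′, c and y are the first nodes of the normal forms of r and r′.
    data Remainder (s : Stmt) (n : ℕ) (y : ResFᵣ Resᵣ) : ResFᵣ (Pending s) → Set₁ where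
      done  : {r : Res} → H (eval s σ r) → NormF _⇝_ n (view r) y → Remainder s n y (retF σ)
      await : (k : ℤ → Pending s) → y ≡ inF (result ∘ k) → Remainder s n y (inF k)
      emit  : (z : Pending s) → y ≡ outF v (result z) → Remainder s n y (outF v z)

    Remainder-weaken : ∀ {y c} → Remainder s n y c → Remainder s (suc n) y c
    Remainder-weaken (done h d)  = done h (NormF-weaken d)
    Remainder-weaken (await k e) = await k e
    Remainder-weaken (emit z e)  = emit z e

    _⊒_ : Res → Pending s → Set₁
    r ⊒ z = r ≈ source z

    -- By recursion on `n`: `ext-δ` removes one delay from both resumptions, and after `ext-ret` the
    -- delays left in `r′` belong to `s`. One bound thus serves for `r` and for what remains.
    split : ∀ n {y} → H (ext s r r′) → NormF _⇝_ n (view r′) y →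
            Σ[ c ∈ ResFᵣ (Pending s) ] NormF _⊒_ n (view r) c × Remainder s n y c
    split n h d with γ h
    ... | ext-ret e h′ =
      _ , NormF-respˡ ≈-trans (≈-unfold e) ⇝ret , done h′ d
    ... | ext-in e e′ k with NormF-respˡ ⇝-respˡ (≈-unfold (≈-sym e′)) d
    ...   | ⇝in N =
      _ , NormF-respˡ ≈-trans (≈-unfold e) (⇝in (λ v → ≈-refl)) ,
      await (λ v → _ , _ , _ , k v , N v) refl
    split n h d | ext-out e e′ k with NormF-respˡ ⇝-respˡ (≈-unfold (≈-sym e′)) d
    ...   | ⇝out N =
      _ , NormF-respˡ ≈-trans (≈-unfold e) (⇝out ≈-refl) ,
      emit (_ , _ , _ , k , N) refl
    split n h d | ext-δ e e′ k with NormF-respˡ ⇝-respˡ (≈-unfold (≈-sym e′)) d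
    ...   | ⇝δ {n = n′} d′ with split n′ k d′
    ...     | c , d₀ , ρ =
      c , NormF-respˡ ≈-trans (≈-unfold e) (⇝δ d₀) , Remainder-weaken ρ

    pending-step : Pending s → ResFᵣ (Pending s)
    pending-step (_ , _ , _ , h , N) = proj₁ (split _ h (proj₂ (⇝-unfold N)))

    normal : Pending s → Resᵣ
    normal = unfoldᵣ pending-step

    normal-⇝ : {r : Res} (z : Pending s) → r ⊒ z → r ⇝ normal z
    normal-⇝ = unfoldᵣ-⇝ pending-step source
      (λ (_ , _ , _ , h , N) → _ , proj₁ (proj₂ (split _ h (proj₂ (⇝-unfold N)))))

    NormF-normal : {c : ResFᵣ (Pending s)} →
                   NormF _⊒_ n x c → NormF _⇝_ n x (mapᵣ normal c)
    NormF-normal = NormF-mapᵣ normal (λ {_} {z} → normal-⇝ z)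

    NormalExt-normal : (z : Pending s) → NormalExt (s , normal z , result z)
    NormalExt-normal z@(r , r′ , q′ , h , N) = r , r′ , h , normal-⇝ z ≈-refl , N

    -- The rules fix `r` only up to `_≈_`, so the other three are refuted by comparing first nodes.
    ext-ret⁻¹ : r ≈ ret σ → H (ext s r r′) → H (eval s σ r′)
    ext-ret⁻¹ e h with γ h
    ... | ext-ret e′ h′ with ≈-unfold (≈-trans (≈-sym e) e′)
    ...   | ≈ret = h′
    ext-ret⁻¹ e h | ext-in e′ _ _ with ≈-unfold (≈-trans (≈-sym e) e′)
    ...   | ()
    ext-ret⁻¹ e h | ext-out e′ _ _ with ≈-unfold (≈-trans (≈-sym e) e′)
    ...   | ()
    ext-ret⁻¹ e h | ext-δ e′ _ _ with ≈-unfold (≈-trans (≈-sym e) e′)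
    ...   | ()

    ext-δ⁻¹ : r ≈ δ r″ → H (ext s r r′) →
              Σ[ p ∈ Res ] Σ[ p′ ∈ Res ] r″ ≈ p × r′ ≈ δ p′ × H (ext s p p′)
    ext-δ⁻¹ e h with γ h
    ... | ext-δ e′ e″ h′ with ≈-unfold (≈-trans (≈-sym e) e′)
    ...   | ≈δ e₁ = _ , _ , e₁ , e″ , h′
    ext-δ⁻¹ e h | ext-ret e′ _ with ≈-unfold (≈-trans (≈-sym e) e′)
    ...   | ()
    ext-δ⁻¹ e h | ext-in e′ _ _ with ≈-unfold (≈-trans (≈-sym e) e′)
    ...   | ()
    ext-δ⁻¹ e h | ext-out e′ _ _ with ≈-unfold (≈-trans (≈-sym e) e′)
    ...   | ()

    ext-δret⁻¹ : H (ext s (δ (ret σ)) r) → Σ[ r′ ∈ Res ] r ≈ δ r′ × H (eval s σ r′)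
    ext-δret⁻¹ h with ext-δ⁻¹ ≈-refl h
    ... | _ , _ , e , e′ , h′ = _ , e′ , ext-ret⁻¹ (≈-sym e) h′

    -- Construction of delay-free derivations.

    module _ {X : Pred (Stmt × Resᵣ × Resᵣ) ℓ} (NormalExt⊆X : NormalExt ⊆ X) where

      -- `X` stays arbitrary because the result is needed both for `NormalExt` and for `⇒*`.
      eval-⇓ : ∀ n s {σ r q} → H (eval s σ r) → NormF _⇝_ n (view r) (viewᵣ q) →
               X ⊢⟨ s , σ ⟩⇓ q
      eval-⇓ n s h d with γ h
      -- Both `q` and the prescribed result are normal forms of `r`; the index 1 accounts for the
      -- delay of the assignment.
      ... | assign e = assign (⇝-unique (⇝-fold d)
                         (⇝-respˡ e (⇝-fold {n = 1} (⇝δ ⇝ret))))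
      ... | skip e = skip (⇝-unique (⇝-fold d)
                         (⇝-respˡ e (⇝-fold {n = 0} ⇝ret)))
      ... | input e = input (⇝-unique (⇝-fold d)
                         (⇝-respˡ e (⇝-fold {n = 0} (⇝in (λ v → ⇝-fold {n = 0} ⇝ret)))))
      ... | output e = output (⇝-unique (⇝-fold d)
                         (⇝-respˡ e (⇝-fold {n = 0} (⇝out (⇝-fold {n = 0} ⇝ret)))))
      ... | while-false ¬t e = while-false (⇝-unique (⇝-fold d)
                         (⇝-respˡ e (⇝-fold {n = 1} (⇝δ ⇝ret)))) ¬t
      eval-⇓ n (s₀ ⨾ s₁) {r = r} h d | seq h₀ h₁ with split n h₁ d
      -- Both calls keep the bound `n` but go to a substatement.
      ... | _ , d₀ , done h₂ d₂ =
        seq-ret (eval-⇓ n s₀ h₀ (NormF-normal d₀)) (eval-⇓ n s₁ h₂ d₂)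
      ... | _ , d₀ , await k e =
        seq-in (NormF-≈ᵣ {r = r} d e) (eval-⇓ n s₀ h₀ (NormF-normal d₀))
          (λ v → NormalExt⊆X (NormalExt-normal (k v)))
      ... | _ , d₀ , emit z e =
        seq-out (NormF-≈ᵣ {r = r} d e) (eval-⇓ n s₀ h₀ (NormF-normal d₀))
          (NormalExt⊆X (NormalExt-normal z))
      eval-⇓ n (if _ then sₜ else _) h d | if-true t h′ with ext-δret⁻¹ h′
      ... | _ , e , h″ with NormF-respˡ ⇝-respˡ (≈-unfold (≈-sym e)) d
      ...   | ⇝δ {n = n′} d′ = if-true t (eval-⇓ n′ sₜ h″ d′)
      eval-⇓ n (if _ then _ else s𝒻) h d | if-false ¬t h′ with ext-δret⁻¹ h′
      ... | _ , e , h″ with NormF-respˡ ⇝-respˡ (≈-unfold (≈-sym e)) d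
      ...   | ⇝δ {n = n′} d′ = if-false ¬t (eval-⇓ n′ s𝒻 h″ d′)
      -- The delay of the guard passes through the result of the body to `r`. Stripping it from both
      -- lowers the bound to `n′`, which permits the call on the same loop.
      eval-⇓ n (while b sₜ) {r = r} h d | while-true t hₜ h′ with ext-δret⁻¹ hₜ
      ... | _ , eₜ , h₀ with ext-δ⁻¹ eₜ h′
      ...   | _ , _ , e₀ , e′ , h₁ with NormF-respˡ ⇝-respˡ (≈-unfold (≈-sym e′)) d
      ...     | ⇝δ {n = n′} d′ with split n′ h₁ d′
      ...       | _ , d₀ , done h₂ d₂ =
        while-ret t
          (eval-⇓ n′ sₜ h₀ (NormF-respˡ ⇝-respˡ (≈-unfold e₀) (NormF-normal d₀)))
          (eval-⇓ n′ (while b sₜ) h₂ d₂)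
      ...       | _ , d₀ , await k e =
        while-in (NormF-≈ᵣ {r = r} d e) t
          (eval-⇓ n′ sₜ h₀ (NormF-respˡ ⇝-respˡ (≈-unfold e₀) (NormF-normal d₀)))
          (λ v → NormalExt⊆X (NormalExt-normal (k v)))
      ...       | _ , d₀ , emit z e =
        while-out (NormF-≈ᵣ {r = r} d e) t
          (eval-⇓ n′ sₜ h₀ (NormF-respˡ ⇝-respˡ (≈-unfold e₀) (NormF-normal d₀)))
          (NormalExt⊆X (NormalExt-normal z))

    NormalExt-respects : ∀ s → (λ q q′ → NormalExt (s , q , q′)) Respects₂ _≈ᵣ_
    NormalExt-respects s =
      (λ e (_ , _ , h , N , N′) → _ , _ , h , N , ⇝-respʳ e N′) ,
      (λ e (_ , _ , h , N , N′) → _ , _ , h , ⇝-respʳ e N , N′)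

    -- Uniqueness identifies the given normal form of the source with the one that `split` finds.
    -- For `*ret` the relation itself serves as `X`.
    NormalExt⊆ExtF : NormalExt ⊆ ExtF NormalExt
    NormalExt⊆ExtF (r , r′ , h , N , N′) with ⇝-unfold N′
    ... | n , d with split n h d
    ...   | _ , d₀ , done h₁ d₁ =
      *ret (⇝-unique N (⇝-fold (NormF-normal d₀)))
        NormalExt NormalExt-respects id (eval-⇓ id n _ h₁ d₁)
    ...   | _ , d₀ , await k e =
      *in (⇝-unique N (⇝-fold (NormF-normal d₀))) (NormF-≈ᵣ {r = r′} d e)
        (λ v → NormalExt-normal (k v))
    ...   | _ , d₀ , emit z e =
      *out (⇝-unique N (⇝-fold (NormF-normal d₀))) (NormF-≈ᵣ {r = r′} d e)
        (NormalExt-normal z)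

proposition6p2 : (L : Language) → let open Semantics L in
    (s : Stmt) (σ : State) (r : Res) (h : r ⇓) →
    ⟨ s , σ ⟩⇒ r → ⟨ s , σ ⟩⇒ᵣ norm r h
proposition6p2 L s σ r h (H , γ , ev) =
  -- Here `X` is `⇒*`: being a post-fixed point, `NormalExt` makes each of its proofs `ρ` a
  -- coinductive derivation.
  eval-⇓ (λ ρ → NormalExt , (λ {p} → NormalExt⊆ExtF {p}) , ρ) n s ev d
  where
  open NormalForms L
  open Evaluation H γ
  nd = ⇝-unfold {r = r} (norm-⇝ h)
  n = proj₁ nd
  d = proj₂ nd
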